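{- Let $n$ be a positive integer, let $r$ be the number of distinct prime factors of $n$, and let $n_0$ be the product of these primes. If $\mathbb{Z}_n$ has a minimal generating set of size $k$, then $k\le r$. Moreover, if $r>2$, then for every positive integer $k$ the set $G_k$ of all minimal generating sets of $\mathbb{Z}_n$ of size $k$ is $$G_k=\Big\{\{g_1,\dots,g_k\}\ :\ g_i\in[d_{s_i}]\ (1\le i\le k)\ \text{with}\ \gcd(d_{s_1},\dots,d_{s_k})=1\ \text{but}\ \gcd(d_{i_1},\dots,d_{i_{k-1}})\neq 1\ \text{for every choice of } k-1 \text{ of the } k \text{ indices } s_1,\dots,s_k\Big\},$$ where $d_{s_1},\dots,d_{s_k}$ are positive divisors of $n_0$ and, for $k=1$, the gcd of the empty family is taken to be $0$.
   Context: $\mathbb{Z}_n=\{0,1,\dots,n-1\}$ is the additive group of integers modulo $n$. A generating set of a group is minimal if no proper subset of it generates the group; its size is its number of (distinct) elements. For a positive divisor $d$ of $n_0$, put $[d]=\{a\in\mathbb{Z}_n : \gcd(a,n_0)=d\}$, with the convention $\gcd(0,n_0)=n_0$. The divisors of $n_0$ are indexed by binary sequences $s$ of length $r$: with $p_1<\dots<p_r$ the primes dividing $n$, $d_s=\prod_i p_i^{s^{(i)}}$ where $s^{(i)}\in\{0,1\}$ is the $i$-th entry of $s$. -}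

module Defs where

open import Algebra.Bundles using (Group; AbelianGroup)
open import Algebra.Structures using (IsAbelianGroup)
open import Data.Fin.Base using (Fin; toℕ)
open import Data.Fin.Properties using (toℕ-injective; toℕ-fromℕ<; toℕ<n)
open import Data.Fin.Subset using (Subset; ⁅_⁆; ⋃; ∣_∣; _⊂_)
import Data.Fin.Subset as Subset
open import Data.List.Base using (List; filter; upTo; length; lookup; tabulate)
open import Data.Nat.Base using (ℕ; suc; _+_; _∸_; _^_; NonZero)
open import Data.Nat.Divisibility using (_∣?_)
open import Data.Nat.DivMod
  using (_%_; _mod_; m%n<n; %-distribˡ-+; m%n%n≡m%n; m<n⇒m%n≡m; n%n≡0; m*n%n≡0)
open import Data.Nat.GCD using (gcd)
open import Data.Nat.ListAction using (product)
open import Data.Nat.Primality using (prime?)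
open import Data.Nat.Properties using (+-assoc; +-comm; m∸n+n≡m; <⇒≤)
open import Data.Product.Base using (_×_; _,_)
open import Data.Vec.Base using (Vec)
import Data.Vec.Base as Vec
open import Data.Vec.Functional using (Vector; foldr)
open import Function.Base using (_∘_)
open import Level using (Level; 0ℓ; _⊔_)
open import Relation.Binary.PropositionalEquality
  using (_≡_; refl; trans; cong; cong₂; isEquivalence; module ≡-Reasoning)
open import Relation.Nullary.Decidable using (_×-dec_)
open import Relation.Nullary.Negation using (¬_)
open import Relation.Unary using (Pred; _∈_; Universal)

module _ {c ℓ : Level} (𝔾 : Group c ℓ) where
  open Group 𝔾 using (Carrier; _≈_; _∙_; ε; _⁻¹)

  -- The subgroup generated by X: the least subset containing X and closed
  -- under the group operations. The last constructor makes it a subset of the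
  -- underlying setoid.
  data ⟨_⟩ {p : Level} (X : Pred Carrier p) : Pred Carrier (c ⊔ ℓ ⊔ p) where
    ∈-gen  : ∀ {x} → x ∈ X → x ∈ ⟨ X ⟩
    ∈-ε    : ε ∈ ⟨ X ⟩
    ∈-∙    : ∀ {x y} → x ∈ ⟨ X ⟩ → y ∈ ⟨ X ⟩ → x ∙ y ∈ ⟨ X ⟩
    ∈-⁻¹   : ∀ {x} → x ∈ ⟨ X ⟩ → x ⁻¹ ∈ ⟨ X ⟩
    ∈-resp : ∀ {x y} → x ≈ y → x ∈ ⟨ X ⟩ → y ∈ ⟨ X ⟩

  Generates : ∀ {p} → Pred Carrier p → Set (c ⊔ ℓ ⊔ p)
  Generates X = Universal ⟨ X ⟩

module _ (n : ℕ) .{{_ : NonZero n}} where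

  infixl 6 _⊕_

  _⊕_ : Fin n → Fin n → Fin n
  a ⊕ b = (toℕ a + toℕ b) mod n

  ⊖_ : Fin n → Fin n
  ⊖ a = (n ∸ toℕ a) mod n

  private
    toℕ-mod : ∀ m → toℕ (m mod n) ≡ m % n
    toℕ-mod m = toℕ-fromℕ< (m%n<n m n)

    toℕ-% : ∀ (a : Fin n) → toℕ a % n ≡ toℕ a
    toℕ-% a = m<n⇒m%n≡m (toℕ<n a)

    %-+ˡ : ∀ a b → (a % n + b) % n ≡ (a + b) % n
    %-+ˡ a b = begin
      (a % n + b) % n          ≡⟨ %-distribˡ-+ (a % n) b n ⟩
      (a % n % n + b % n) % n  ≡⟨ cong (λ t → (t + b % n) % n) (m%n%n≡m%n a n) ⟩
      (a % n + b % n) % n      ≡⟨ %-distribˡ-+ a b n ⟨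
      (a + b) % n              ∎
      where open ≡-Reasoning

    ⊕-comm : ∀ a b → a ⊕ b ≡ b ⊕ a
    ⊕-comm a b = cong (_mod n) (+-comm (toℕ a) (toℕ b))

    toℕ-⊕ˡ : ∀ m b → toℕ ((m mod n) ⊕ b) ≡ (m + toℕ b) % n
    toℕ-⊕ˡ m b = begin
      toℕ ((m mod n) ⊕ b)            ≡⟨ toℕ-mod _ ⟩
      (toℕ (m mod n) + toℕ b) % n    ≡⟨ cong (λ t → (t + toℕ b) % n) (toℕ-mod m) ⟩
      (m % n + toℕ b) % n            ≡⟨ %-+ˡ m (toℕ b) ⟩
      (m + toℕ b) % n                ∎
      where open ≡-Reasoning

    ⊕-assoc : ∀ a b c → (a ⊕ b) ⊕ c ≡ a ⊕ (b ⊕ c)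
    ⊕-assoc a b c = toℕ-injective (begin
      toℕ ((a ⊕ b) ⊕ c)              ≡⟨ toℕ-⊕ˡ (toℕ a + toℕ b) c ⟩
      (toℕ a + toℕ b + toℕ c) % n    ≡⟨ cong (_% n) (+-assoc (toℕ a) (toℕ b) (toℕ c)) ⟩
      (toℕ a + (toℕ b + toℕ c)) % n  ≡⟨ cong (_% n) (+-comm (toℕ a) _) ⟩
      (toℕ b + toℕ c + toℕ a) % n    ≡⟨ toℕ-⊕ˡ (toℕ b + toℕ c) a ⟨
      toℕ ((b ⊕ c) ⊕ a)              ≡⟨ cong toℕ (⊕-comm (b ⊕ c) a) ⟩
      toℕ (a ⊕ (b ⊕ c))              ∎)
      where open ≡-Reasoning

    ⊕-identityˡ : ∀ a → (0 mod n) ⊕ a ≡ a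
    ⊕-identityˡ a = toℕ-injective (trans (toℕ-⊕ˡ 0 a) (toℕ-% a))

    ⊖-inverseˡ : ∀ a → (⊖ a) ⊕ a ≡ 0 mod n
    ⊖-inverseˡ a = toℕ-injective (begin
      toℕ ((⊖ a) ⊕ a)              ≡⟨ toℕ-⊕ˡ (n ∸ toℕ a) a ⟩
      (n ∸ toℕ a + toℕ a) % n      ≡⟨ cong (_% n) (m∸n+n≡m (<⇒≤ (toℕ<n a))) ⟩
      n % n                        ≡⟨ n%n≡0 n ⟩
      0                            ≡⟨ m*n%n≡0 0 n ⟨
      0 % n                        ≡⟨ toℕ-mod 0 ⟨
      toℕ (0 mod n)                ∎)
      where open ≡-Reasoning

    ⊕-isAbelianGroup : IsAbelianGroup _≡_ _⊕_ (0 mod n) ⊖_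
    ⊕-isAbelianGroup = record
      { isGroup = record
        { isMonoid = record
          { isSemigroup = record
            { isMagma = record { isEquivalence = isEquivalence ; ∙-cong = cong₂ _⊕_ }
            ; assoc = ⊕-assoc
            }
          ; identity = ⊕-identityˡ , λ a → trans (⊕-comm a _) (⊕-identityˡ a)
          }
        ; inverse = ⊖-inverseˡ , λ a → trans (⊕-comm a _) (⊖-inverseˡ a)
        ; ⁻¹-cong = cong ⊖_
        }
      ; comm = ⊕-comm
      }

  ℤ/ : AbelianGroup 0ℓ 0ℓ
  ℤ/ = record { isAbelianGroup = ⊕-isAbelianGroup }

  IsGeneratingSet : Pred (Subset n) 0ℓ
  IsGeneratingSet S = Generates (AbelianGroup.group ℤ/) (Subset._∈ S)

  IsMinimalGeneratingSet : Pred (Subset n) 0ℓ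
  IsMinimalGeneratingSet S = IsGeneratingSet S × (∀ T → T ⊂ S → ¬ IsGeneratingSet T)

  G : ℕ → Pred (Subset n) 0ℓ
  G k S = IsMinimalGeneratingSet S × ∣ S ∣ ≡ k

module _ (n : ℕ) where

  -- In increasing order, since upTo enumerates 0, 1, …, n.
  primeDivisors : List ℕ
  primeDivisors = filter (λ p → prime? p ×-dec p ∣? n) (upTo (suc n))

  r : ℕ
  r = length primeDivisors

  n₀ : ℕ
  n₀ = product primeDivisors

  d : Vec (Fin 2) r → ℕ
  d s = product (tabulate λ i → lookup primeDivisors i ^ toℕ (Vec.lookup s i))

-- No convention for 0 is needed, as gcd 0 m = m.
[_] : ∀ {n} → ℕ → Pred (Fin n) 0ℓ
[_] {n} e a = gcd (toℕ a) (n₀ n) ≡ e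

-- The empty family has gcd 0.
gcds : ∀ {k} → Vector ℕ k → ℕ
gcds = foldr gcd 0

setOf : ∀ {n k} → Vector (Fin n) k → Subset n
setOf g = ⋃ (tabulate (⁅_⁆ ∘ g))

{-# OPTIONS --safe #-}

-- A subset S of ℤ/n generates iff no prime divides n together with every
-- element of S: the multiples of p form a proper subgroup, and conversely
-- Bézout puts 1 in ⟨ S ⟩. So if S is minimal, removing a ∈ S leaves a
-- non-generating set, which yields a prime divisor of n dividing all elements
-- of S but a; these primes are distinct for distinct a, whence ∣ S ∣ ≤ r n.
-- The same criterion, read for gcd (a, n₀) in place of a, is the condition on
-- the d_{sᵢ}, and it forces the gᵢ to be distinct.

module Submission where

open import Defs
open import Algebra.Bundles using (AbelianGroup)
import Algebra.Properties.Group as GroupProperties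
open import Data.Bool.Base using (true; false)
open import Data.Empty using (⊥-elim)
open import Data.Fin.Base using (Fin; zero; suc; toℕ; fromℕ<; punchIn; punchOut)
open import Data.Fin.Properties
  using (toℕ-injective; toℕ-fromℕ<; toℕ<n; suc-injective; injective⇒≤;
         punchInᵢ≢i; punchIn-punchOut)
  renaming (_≟_ to _≟ᶠ_)
open import Data.Fin.Subset using (Subset; ⁅_⁆; _∪_; _⊂_; _⊆_)
import Data.Fin.Subset as Subset
open import Data.Fin.Subset.Properties
  using (x∈⁅x⁆; x∈⁅y⁆⇒x≡y; x∈p∪q⁺; x∈p∪q⁻; ⊆-antisym; ∉⊥; ∣⊥∣≡0; ∪-identityˡ)
open import Data.List.Base using ([]; _∷_; lookup; tabulate; upTo)
open import Data.List.Membership.Propositional renaming (_∈_ to _∈ˡ_)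
open import Data.List.Membership.Propositional.Properties
  using (∈-filter⁺; ∈-filter⁻; ∈-upTo⁺; ∈-lookup)
open import Data.List.Relation.Unary.All as All using (All; []; _∷_)
open import Data.List.Relation.Unary.Any using (index)
open import Data.List.Relation.Unary.Any.Properties using (lookup-index)
open import Data.Nat.Base
  using (ℕ; zero; suc; _+_; _*_; _^_; _≤_; _<_; z≤n; s≤s; NonZero)
open import Data.Nat.Coprimality using (coprime-divisor)
open import Data.Nat.Divisibility
open import Data.Nat.DivMod using (_%_; _mod_; m%n<n; %-distribˡ-+; m<n⇒m%n≡m; n%n≡0; m*n%n≡0)
open import Data.Nat.GCD
open import Data.Nat.ListAction using (product)
open import Data.Nat.ListAction.Properties using (∈⇒∣product)
open import Data.Nat.Primality
open import Data.Nat.Primality.Factorisation using (factorise)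
open import Data.Nat.Properties
  using (_≟_; *-identityʳ; *-identityˡ; *-comm; m+[n∸m]≡n; <⇒≤; ≤-trans)
open import Data.Product.Base using (_×_; _,_; ∃-syntax; Σ-syntax; proj₁; proj₂)
open import Data.Sum.Base using (inj₁; inj₂; [_,_]′)
open import Data.Vec.Base using (Vec; []; _∷_; here; there)
import Data.Vec.Base as Vec
open import Data.Vec.Functional using (Vector; removeAt)
import Data.Vec.Functional as F
open import Function.Base using (_∘_)
open import Function.Definitions using (Injective)
open import Relation.Binary.PropositionalEquality
  using (_≡_; _≢_; refl; sym; trans; cong; cong₂; subst; module ≡-Reasoning)
open import Relation.Nullary.Decidable using (yes; no; _×-dec_)
open import Relation.Nullary.Negation using (¬_; contradiction)
open import Relation.Unary using (_∈_; _≐_; Satisfiable)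

private
  variable
    n k p : ℕ

-- Primes and gcds of finite families.

prime∤1 : Prime p → p ∤ 1
prime∤1 p-prime p∣1 = ¬prime[1] (subst Prime (∣1⇒≡1 p∣1) p-prime)

≢1⇒prime-divisor : ∀ m → m ≢ 1 → ∃[ p ] Prime p × p ∣ m
-- Every prime divides 0, so 2 is an arbitrary choice; this case serves the empty family, whose gcd
-- is 0.
≢1⇒prime-divisor zero    _   = 2 , prime[2] , (2 ∣0)
≢1⇒prime-divisor (suc m) m≢1 with factorise (suc m)
... | record { factors = [] ; isFactorisation = eq } = contradiction eq m≢1
... | record { factors = q ∷ qs ; isFactorisation = eq ; factorsPrime = q-prime ∷ _ } =
  q , q-prime , subst (q ∣_) (sym eq) (m∣m*n (product qs))

-- By Euclid's lemma `p` divides a factor of the product, and that factor divides `m`. With the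
-- prime divisors of `n` as factors, it takes primes from `n₀` back to `n`.
prime∣product⇒∣ : ∀ {m qs} → Prime p → All (_∣ m) qs → p ∣ product qs → p ∣ m
prime∣product⇒∣ p-prime []             p∣1 = contradiction p∣1 (prime∤1 p-prime)
prime∣product⇒∣ {qs = q ∷ qs} p-prime (q∣m ∷ qs∣m) p∣qΠ =
  [ (λ p∣q → ∣-trans p∣q q∣m) , prime∣product⇒∣ p-prime qs∣m ]′
    (euclidsLemma q (product qs) p-prime p∣qΠ)

gcds∣ : (x : Vector ℕ k) → ∀ i → gcds x ∣ x i
gcds∣ x zero    = gcd[m,n]∣m (x zero) (gcds (F.tail x))
gcds∣ x (suc i) = ∣-trans (gcd[m,n]∣n (x zero) _) (gcds∣ (F.tail x) i)

gcds-greatest : ∀ {e} (x : Vector ℕ k) → (∀ i → e ∣ x i) → e ∣ gcds x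
gcds-greatest {zero}  x e∣x = _ ∣0
gcds-greatest {suc k} x e∣x = gcd-greatest (e∣x zero) (gcds-greatest (F.tail x) (e∣x ∘ suc))

gcds≡1⇒∤ : (x : Vector ℕ k) → gcds x ≡ 1 → Prime p → ¬ (∀ i → p ∣ x i)
gcds≡1⇒∤ x eq p-prime p∣x = prime∤1 p-prime (subst (_ ∣_) eq (gcds-greatest x p∣x))

gcds≢1⇒∣ : (x : Vector ℕ k) → gcds x ≢ 1 → ∃[ p ] Prime p × (∀ i → p ∣ x i)
gcds≢1⇒∣ x neq =
  let p , p-prime , p∣ = ≢1⇒prime-divisor (gcds x) neq
  in  p , p-prime , λ i → ∣-trans p∣ (gcds∣ x i)

-- The gcd of a number with `n₀`.

-- A common divisor of `a` and `q * m` is coprime to `q`, since `q` is prime and does not divide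
-- `a`; hence it already divides `m`.
gcd-prime-*-∤ : ∀ {q a} m → Prime q → q ∤ a → gcd a (q * m) ≡ gcd a m
gcd-prime-*-∤ {q} {a} m q-prime q∤a = ∣-antisym
  (gcd-greatest (gcd[m,n]∣m a (q * m)) (coprime-divisor coprime (gcd[m,n]∣n a (q * m))))
  (gcd-greatest (gcd[m,n]∣m a m) (∣n⇒∣m*n q (gcd[m,n]∣n a m)))
  where
  coprime : ∀ {i} → i ∣ gcd a (q * m) × i ∣ q → i ≡ 1
  coprime (i∣g , i∣q) with prime⇒irreducible q-prime i∣q
  ... | inj₁ i≡1  = i≡1
  ... | inj₂ refl = contradiction (∣-trans i∣g (gcd[m,n]∣m a (q * m))) q∤a

-- The bit of `q` records whether `q` divides the current number. If it does, one factor `q` comes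
-- out of both arguments of the gcd, and the induction goes on with the quotient `b`; if not, `q` is
-- dropped from the product.
gcd-product-bits : ∀ qs → All Prime qs → ∀ a → ∃[ s ]
  gcd a (product qs) ≡ product (tabulate λ i → lookup qs i ^ toℕ (Vec.lookup {A = Fin 2} s i))
gcd-product-bits [] [] a = [] , gcd-zeroʳ a
gcd-product-bits (q ∷ qs) (q-prime ∷ qs-prime) a with q ∣? a
... | no q∤a =
  let s , eq = gcd-product-bits qs qs-prime a
  in  zero ∷ s , trans (gcd-prime-*-∤ _ q-prime q∤a) (trans eq (sym (*-identityˡ _)))
... | yes (divides b refl) =
  let s , eq = gcd-product-bits qs qs-prime b
  in  suc zero ∷ s , (begin
    gcd (b * q) (q * product qs)  ≡⟨ cong (λ t → gcd t (q * product qs)) (*-comm b q) ⟩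
    gcd (q * b) (q * product qs)  ≡⟨ c*gcd[m,n]≡gcd[cm,cn] q b (product qs) ⟨
    q * gcd b (product qs)        ≡⟨ cong₂ _*_ (sym (*-identityʳ q)) eq ⟩
    q ^ 1 * _                     ∎)
  where open ≡-Reasoning

primeDivisors⁻ : ∀ n {q} → q ∈ˡ primeDivisors n → Prime q × q ∣ n
primeDivisors⁻ n q∈ = proj₂ (∈-filter⁻ (λ q → prime? q ×-dec q ∣? n) {xs = upTo (suc n)} q∈)

primeDivisors⁺ : ∀ n .{{_ : NonZero n}} → Prime p → p ∣ n → p ∈ˡ primeDivisors n
primeDivisors⁺ n p-prime p∣n =
  -- A divisor of the nonzero `n` is at most `n`, and `upTo (suc n)` still includes `n`.
  ∈-filter⁺ (λ q → prime? q ×-dec q ∣? n) (∈-upTo⁺ (s≤s (∣⇒≤ p∣n))) (p-prime , p∣n)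

prime∣n₀⇒∣n : ∀ n → Prime p → p ∣ n₀ n → p ∣ n
prime∣n₀⇒∣n n p-prime = prime∣product⇒∣ p-prime (All.tabulate (proj₂ ∘ primeDivisors⁻ n))

prime∣n⇒∣n₀ : ∀ n .{{_ : NonZero n}} → Prime p → p ∣ n → p ∣ n₀ n
prime∣n⇒∣n₀ n p-prime p∣n = ∈⇒∣product (primeDivisors⁺ n p-prime p∣n)

gcd-n₀-bits : ∀ n a → ∃[ s ] gcd a (n₀ n) ≡ d n s
gcd-n₀-bits n = gcd-product-bits (primeDivisors n) (All.tabulate (proj₁ ∘ primeDivisors⁻ n))

-- Finite families and the subsets they list.

∈-setOf⁺ : (g : Vector (Fin n) k) → ∀ i → g i Subset.∈ setOf g
∈-setOf⁺ g zero    = x∈p∪q⁺ (inj₁ (x∈⁅x⁆ (g zero)))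
∈-setOf⁺ g (suc i) = x∈p∪q⁺ {p = ⁅ g zero ⁆} (inj₂ (∈-setOf⁺ (F.tail g) i))

∈-setOf⁻ : (g : Vector (Fin n) k) → ∀ {x} → x Subset.∈ setOf g → ∃[ i ] x ≡ g i
∈-setOf⁻ {k = zero}  g x∈ = contradiction x∈ ∉⊥
∈-setOf⁻ {k = suc k} g x∈ with x∈p∪q⁻ ⁅ g zero ⁆ (setOf (F.tail g)) x∈
... | inj₁ x∈⁅⁆ = zero , x∈⁅y⁆⇒x≡y (g zero) x∈⁅⁆
... | inj₂ x∈′  = let i , eq = ∈-setOf⁻ (F.tail g) x∈′ in suc i , eq

∣⁅x⁆∪p∣ : (x : Fin n) (S : Subset n) → ¬ (x Subset.∈ S) → Subset.∣ ⁅ x ⁆ ∪ S ∣ ≡ suc Subset.∣ S ∣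
∣⁅x⁆∪p∣ zero    (true  ∷ S) x∉S = contradiction here x∉S
∣⁅x⁆∪p∣ zero    (false ∷ S) x∉S = cong (suc ∘ Subset.∣_∣) (∪-identityˡ S)
∣⁅x⁆∪p∣ (suc x) (true  ∷ S) x∉S = cong suc (∣⁅x⁆∪p∣ x S (x∉S ∘ there))
∣⁅x⁆∪p∣ (suc x) (false ∷ S) x∉S = ∣⁅x⁆∪p∣ x S (x∉S ∘ there)

∣setOf∣ : (g : Vector (Fin n) k) → Injective _≡_ _≡_ g → Subset.∣ setOf g ∣ ≡ k
∣setOf∣ {n} {zero}  g inj = ∣⊥∣≡0 n
∣setOf∣ {n} {suc k} g inj = trans
  (∣⁅x⁆∪p∣ (g zero) (setOf (F.tail g)) λ g₀∈ →
    let i , eq = ∈-setOf⁻ (F.tail g) g₀∈ in contradiction (inj eq) λ ())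
  (cong suc (∣setOf∣ (F.tail g) (suc-injective ∘ inj)))

enumerate : (S : Subset n) → Vector (Fin n) Subset.∣ S ∣
enumerate (true  ∷ S) zero    = zero
enumerate (true  ∷ S) (suc i) = suc (enumerate S i)
enumerate (false ∷ S) i       = suc (enumerate S i)

enumerate-injective : (S : Subset n) → Injective _≡_ _≡_ (enumerate S)
enumerate-injective (true  ∷ S) {zero}  {zero}  eq = refl
enumerate-injective (true  ∷ S) {suc i} {suc j} eq =
  cong suc (enumerate-injective S (suc-injective eq))
enumerate-injective (false ∷ S) eq = enumerate-injective S (suc-injective eq)

enumerate-∈ : (S : Subset n) → ∀ i → enumerate S i Subset.∈ S
enumerate-∈ (true  ∷ S) zero    = here
enumerate-∈ (true  ∷ S) (suc i) = there (enumerate-∈ S i)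
enumerate-∈ (false ∷ S) i       = there (enumerate-∈ S i)

enumerate-surjective : (S : Subset n) → ∀ {x} → x Subset.∈ S → ∃[ i ] enumerate S i ≡ x
enumerate-surjective (true  ∷ S) here = zero , refl
enumerate-surjective (true  ∷ S) (there x∈S) =
  let i , eq = enumerate-surjective S x∈S in suc i , cong suc eq
enumerate-surjective (false ∷ S) (there x∈S) =
  let i , eq = enumerate-surjective S x∈S in i , cong suc eq

setOf-enumerate : (S : Subset n) → S ≡ setOf (enumerate S)
setOf-enumerate S = ⊆-antisym
  (λ x∈S → let i , eq = enumerate-surjective S x∈S
           in subst (Subset._∈ _) eq (∈-setOf⁺ (enumerate S) i))
  (λ x∈ → let i , eq = ∈-setOf⁻ (enumerate S) x∈
          in subst (Subset._∈ S) (sym eq) (enumerate-∈ S i))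

-- Passing to an injective family lets the deletion of an element be expressed by `removeAt`,
-- matching the choice of all indices but one.
toFamily : (S : Subset n) → Subset.∣ S ∣ ≡ k →
           Σ[ g ∈ Vector (Fin n) k ] Injective _≡_ _≡_ g × S ≡ setOf g
toFamily S refl = enumerate S , enumerate-injective S , setOf-enumerate S

∈-setOf-removeAt : (g : Vector (Fin n) (suc k)) → ∀ {i j} → j ≢ i →
                   g i Subset.∈ setOf (removeAt g j)
∈-setOf-removeAt g {i} {j} j≢i = subst (λ t → g t Subset.∈ setOf (removeAt g j))
  (punchIn-punchOut j≢i) (∈-setOf⁺ (removeAt g j) (punchOut j≢i))

setOf-removeAt-⊂ : (g : Vector (Fin n) (suc k)) → Injective _≡_ _≡_ g →
                   ∀ j → setOf (removeAt g j) ⊂ setOf g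
setOf-removeAt-⊂ g inj j =
  (λ x∈ → let i , eq = ∈-setOf⁻ (removeAt g j) x∈
          in subst (Subset._∈ setOf g) (sym eq) (∈-setOf⁺ g (punchIn j i))) ,
  g j , ∈-setOf⁺ g j ,
  λ gj∈ → let i , eq = ∈-setOf⁻ (removeAt g j) gj∈
          in punchInᵢ≢i j i (sym (inj eq))

-- Spans in `ℤ/ n` and the prime criterion for generating.

module _ (n : ℕ) .{{_ : NonZero n}} where

  private
    module ℤₙ = AbelianGroup (ℤ/ n)
    open GroupProperties ℤₙ.group using (\\-leftDividesʳ)

    toℕ-mod : ∀ m → toℕ (m mod n) ≡ m % n
    toℕ-mod m = toℕ-fromℕ< (m%n<n m n)

  mod-+ : ∀ a b → (a mod n) ℤₙ.∙ (b mod n) ≡ (a + b) mod n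
  mod-+ a b = toℕ-injective (begin
    toℕ ((a mod n) ℤₙ.∙ (b mod n))       ≡⟨ toℕ-mod _ ⟩
    (toℕ (a mod n) + toℕ (b mod n)) % n  ≡⟨ cong₂ (λ s t → (s + t) % n) (toℕ-mod a) (toℕ-mod b) ⟩
    (a % n + b % n) % n                  ≡⟨ %-distribˡ-+ a b n ⟨
    (a + b) % n                          ≡⟨ toℕ-mod (a + b) ⟨
    toℕ ((a + b) mod n)                  ∎)
    where open ≡-Reasoning

  toℕ-mod-id : ∀ (a : Fin n) → toℕ a mod n ≡ a
  toℕ-mod-id a = toℕ-injective (trans (toℕ-mod (toℕ a)) (m<n⇒m%n≡m (toℕ<n a)))

  n-mod-n : n mod n ≡ 0 mod n
  n-mod-n = toℕ-injective (begin
    toℕ (n mod n)  ≡⟨ toℕ-mod n ⟩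
    n % n          ≡⟨ n%n≡0 n ⟩
    0              ≡⟨ m*n%n≡0 0 n ⟨
    0 % n          ≡⟨ toℕ-mod 0 ⟨
    toℕ (0 mod n)  ∎)
    where open ≡-Reasoning

  Span : Subset n → Fin n → Set
  Span S = ⟨ ℤₙ.group ⟩ (Subset._∈ S)

  module _ {S : Subset n} where

    -- As `e` divides `n`, reduction modulo `n` preserves divisibility by `e`, so the multiples of
    -- `e` form a subgroup.
    ∣S⇒∣Span : ∀ {e} → e ∣ n → (∀ {x} → x Subset.∈ S → e ∣ toℕ x) →
              ∀ {x} → Span S x → e ∣ toℕ x
    ∣S⇒∣Span {e} e∣n e∣S = go
      where
      ∣-mod : ∀ {m} → e ∣ m → e ∣ toℕ (m mod n)
      ∣-mod {m} e∣m = subst (e ∣_) (sym (toℕ-mod m)) (%-presˡ-∣ e∣m e∣n)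

      go : ∀ {x} → Span S x → e ∣ toℕ x
      go (∈-gen x∈S)      = e∣S x∈S
      go ∈-ε              = ∣-mod (e ∣0)
      go (∈-∙ x∈ y∈)      = ∣-mod (∣m∣n⇒∣m+n (go x∈) (go y∈))
      -- `e` divides `n`, which is `toℕ x` plus the representative `n ∸ toℕ x` of the inverse, and
      -- it divides the first summand.
      go (∈-⁻¹ {x} x∈)    = ∣-mod (∣m+n∣m⇒∣n (subst (e ∣_) (sym (m+[n∸m]≡n (<⇒≤ (toℕ<n x)))) e∣n) (go x∈))
      go (∈-resp refl x∈) = go x∈

    mod-*-closed : ∀ {a} m → Span S (a mod n) → Span S ((m * a) mod n)
    mod-*-closed zero    a∈ = ∈-ε
    mod-*-closed (suc m) a∈ = ∈-resp (mod-+ _ _) (∈-∙ a∈ (mod-*-closed m a∈))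

    -- Adding the inverse of `b` to `a + b` recovers `a`. This form fits Bézout's identity over the
    -- natural numbers, which reads gcd + yb = xa or gcd + xa = yb.
    mod-∸-closed : ∀ {a b} → Span S (b mod n) → Span S ((a + b) mod n) → Span S (a mod n)
    mod-∸-closed {a} {b} b∈ a+b∈ =
      ∈-resp (trans (cong (_ ℤₙ.∙_) (trans (sym (mod-+ a b)) (ℤₙ.comm (a mod n) (b mod n))))
                    (\\-leftDividesʳ (b mod n) (a mod n)))
             (∈-∙ (∈-⁻¹ b∈) a+b∈)

    mod-gcd-closed : ∀ {a b} → Span S (a mod n) → Span S (b mod n) → Span S (gcd a b mod n)
    mod-gcd-closed {a} {b} a∈ b∈ with Bézout.identity (gcd-GCD a b)
    ... | Bézout.+- x y eq = mod-∸-closed (mod-*-closed y b∈)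
      (subst (λ t → Span S (t mod n)) (sym eq) (mod-*-closed x a∈))
    ... | Bézout.-+ x y eq = mod-∸-closed (mod-*-closed x a∈)
      (subst (λ t → Span S (t mod n)) (sym eq) (mod-*-closed y b∈))

    mod-gcds-closed : (x : Vector ℕ k) → (∀ i → Span S (x i mod n)) → Span S (gcds x mod n)
    mod-gcds-closed {zero}  x x∈ = ∈-ε
    mod-gcds-closed {suc k} x x∈ =
      mod-gcd-closed {a = x zero} (x∈ zero) (mod-gcds-closed (F.tail x) (x∈ ∘ suc))

  generates-mono : {S T : Subset n} → S ⊆ T → IsGeneratingSet n S → IsGeneratingSet n T
  generates-mono {S} {T} S⊆T S-gen x = go (S-gen x)
    where
    go : ∀ {x} → Span S x → Span T x
    go (∈-gen x∈S)      = ∈-gen (S⊆T x∈S)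
    go ∈-ε              = ∈-ε
    go (∈-∙ x∈ y∈)      = ∈-∙ (go x∈) (go y∈)
    go (∈-⁻¹ x∈)        = ∈-⁻¹ (go x∈)
    go (∈-resp refl x∈) = go x∈

  -- Otherwise the whole span, in particular the class of 1, would consist of multiples of `p`;
  -- since `p` divides `n`, it would then divide 1 itself.
  generates⇒∤ : (g : Vector (Fin n) k) → IsGeneratingSet n (setOf g) →
                Prime p → p ∣ n → ¬ (∀ i → p ∣ toℕ (g i))
  generates⇒∤ g gen p-prime p∣n p∣g = prime∤1 p-prime
    (∣n∣m%n⇒∣m p∣n (subst (_ ∣_) (toℕ-mod 1) (∣S⇒∣Span p∣n p∣S (gen (1 mod n)))))
    where
    p∣S : ∀ {x} → x Subset.∈ setOf g → _ ∣ toℕ x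
    p∣S x∈ = let i , eq = ∈-setOf⁻ g x∈ in subst ((_ ∣_) ∘ toℕ) (sym eq) (p∣g i)

  -- The entry `n` in front of the family represents 0 and so costs nothing in the span. Bézout
  -- therefore places 1 in the span, and each `x` is `toℕ x` times 1.
  gcds≡1⇒generates : (g : Vector (Fin n) k) → gcds (n F.∷ toℕ ∘ g) ≡ 1 →
                     IsGeneratingSet n (setOf g)
  gcds≡1⇒generates g eq x =
    ∈-resp (trans (cong (_mod n) (*-identityʳ (toℕ x))) (toℕ-mod-id x))
      (mod-*-closed (toℕ x)
        (subst (λ t → Span (setOf g) (t mod n)) eq (mod-gcds-closed (n F.∷ toℕ ∘ g) λ where
          zero    → ∈-resp (sym n-mod-n) ∈-ε
          (suc i) → ∈-resp (sym (toℕ-mod-id (g i))) (∈-gen (∈-setOf⁺ g i)))))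

  -- Because `n` is itself an entry of the family whose gcd is taken, the prime obtained divides `n`
  -- as well as all the generators.
  ¬generates⇒∣ : (g : Vector (Fin n) k) → ¬ IsGeneratingSet n (setOf g) →
                 ∃[ p ] Prime p × p ∣ n × (∀ i → p ∣ toℕ (g i))
  ¬generates⇒∣ g ¬gen =
    let p , p-prime , p∣ = gcds≢1⇒∣ (n F.∷ toℕ ∘ g) (¬gen ∘ gcds≡1⇒generates g)
    in  p , p-prime , p∣ zero , p∣ ∘ suc

  -- The bound on the size of a minimal generating set.

  -- The prime `q j` found on deleting `g j` is recorded by its position in `primeDivisors n`, so
  -- the bound becomes injectivity of a map into `Fin (r n)`.
  minimal⇒≤r : ∀ k S → S ∈ G n k → k ≤ r n
  minimal⇒≤r zero    _ _ = z≤n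
  minimal⇒≤r (suc m) S ((S-gen , S-min) , ∣S∣≡k) with toFamily S ∣S∣≡k
  ... | g , g-inj , refl = injective⇒≤ {f = f} f-inj
    where
    witness : ∀ j → ∃[ p ] Prime p × p ∣ n × (∀ i → p ∣ toℕ (removeAt g j i))
    witness j = ¬generates⇒∣ (removeAt g j) (S-min _ (setOf-removeAt-⊂ g g-inj j))

    q : Fin (suc m) → ℕ
    q j = proj₁ (witness j)

    q∈ : ∀ j → q j ∈ˡ primeDivisors n
    q∈ j = let _ , q-prime , q∣n , _ = witness j in primeDivisors⁺ n q-prime q∣n

    q∣ : ∀ {i j} → j ≢ i → q j ∣ toℕ (g i)
    q∣ {i} {j} j≢i = subst (λ t → q j ∣ toℕ (g t)) (punchIn-punchOut j≢i)
      (proj₂ (proj₂ (proj₂ (witness j))) (punchOut j≢i))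

    f : Fin (suc m) → Fin (r n)
    f j = index (q∈ j)

    f-inj : Injective _≡_ _≡_ f
    f-inj {i} {j} eq with i ≟ᶠ j
    ... | yes i≡j = i≡j
    -- If two indices shared a prime, that prime would divide every generator, contrary to the
    -- criterion.
    ... | no  i≢j = let _ , q-prime , q∣n , _ = witness i in
      contradiction q∣g (generates⇒∤ g S-gen q-prime q∣n)
      where
      qi≡qj : q i ≡ q j
      qi≡qj = trans (lookup-index (q∈ i))
        (trans (cong (lookup (primeDivisors n)) eq) (sym (lookup-index (q∈ j))))

      q∣g : ∀ l → q i ∣ toℕ (g l)
      q∣g l with i ≟ᶠ l
      ... | no  i≢l  = q∣ i≢l
      -- `q i` says nothing about `g i`, but `q j` divides it, as `i` differs from `j`.
      ... | yes refl = subst (_∣ toℕ (g i)) (sym qi≡qj) (q∣ (i≢j ∘ sym))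

  -- Minimal generating sets in terms of divisors of `n₀`.

  module _ (g : Vector (Fin n) k) (s : Vector (Vec (Fin 2) (r n)) k)
           (g∈ : ∀ i → g i ∈ [ d n (s i) ]) where

    -- A prime dividing `n` and every `g i` also divides `n₀`, hence each gcd of `g i` with `n₀`,
    -- which is `d n (s i)`.
    gcds-d≡1⇒generates : gcds (d n ∘ s) ≡ 1 → IsGeneratingSet n (setOf g)
    gcds-d≡1⇒generates eq with gcds (n F.∷ toℕ ∘ g) ≟ 1
    ... | yes coprime = gcds≡1⇒generates g coprime
    ... | no  neq =
      let p , p-prime , p∣ = gcds≢1⇒∣ (n F.∷ toℕ ∘ g) neq in
      ⊥-elim (gcds≡1⇒∤ (d n ∘ s) eq p-prime λ i →
        subst (p ∣_) (g∈ i) (gcd-greatest (p∣ (suc i)) (prime∣n⇒∣n₀ n p-prime (p∣ zero))))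

  -- Nontriviality of n matters for k = 0 only: ∅ generates ℤ/1, but gcds [] = 0.
  generates⇒gcds-d≡1 : 0 < r n → (g : Vector (Fin n) k) (s : Vector (Vec (Fin 2) (r n)) k) →
    (∀ i → g i ∈ [ d n (s i) ]) → IsGeneratingSet n (setOf g) → gcds (d n ∘ s) ≡ 1
  generates⇒gcds-d≡1 {k} 0<r g s g∈ gen with gcds (d n ∘ s) ≟ 1
  ... | yes eq = eq
  ... | no neq = ⊥-elim (contra k g s g∈ gen (gcds≢1⇒∣ (d n ∘ s) neq))
    where
    contra : ∀ k (g : Vector (Fin n) k) (s : Vector (Vec (Fin 2) (r n)) k) →
      (∀ i → g i ∈ [ d n (s i) ]) → IsGeneratingSet n (setOf g) →
      ¬ (∃[ p ] Prime p × (∀ i → p ∣ d n (s i)))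
    -- The given prime divides the entries of the empty family only vacuously and may fail to divide
    -- `n`. It is replaced by the first prime in `primeDivisors n`.
    contra zero g _ _ gen _ =
      let q-prime , q∣n = primeDivisors⁻ n (∈-lookup (fromℕ< 0<r))
      in  generates⇒∤ g gen q-prime q∣n λ ()
    contra (suc _) g s g∈ gen (p , p-prime , p∣d) =
      generates⇒∤ g gen p-prime
        -- The family is nonempty, so its first entry witnesses that `p` divides `n₀`, hence `n`.
        (prime∣n₀⇒∣n n p-prime (∣-trans (p∣gcd zero) (gcd[m,n]∣n (toℕ (g zero)) (n₀ n))))
        (λ i → ∣-trans (p∣gcd i) (gcd[m,n]∣m (toℕ (g i)) (n₀ n)))
      where
      p∣gcd : ∀ i → p ∣ gcd (toℕ (g i)) (n₀ n)
      p∣gcd i = subst (p ∣_) (sym (g∈ i)) (p∣d i)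

  IsMinimalFamily : ∀ {m} → Vector (Fin n) (suc m) → Vector (Vec (Fin 2) (r n)) (suc m) → Set
  IsMinimalFamily g s =
    (∀ i → g i ∈ [ d n (s i) ]) ×
    gcds (d n ∘ s) ≡ 1 ×
    (∀ j → gcds (removeAt (d n ∘ s) j) ≢ 1)

  -- The bits of `s` are read off from the gcds with `n₀`. If the remaining divisors had gcd 1 after
  -- a deletion, the corresponding proper subset would still generate.
  minimal⇒family : ∀ {m S} → S ∈ G n (suc m) → 0 < r n →
    Σ[ g ∈ Vector (Fin n) (suc m) ] Σ[ s ∈ Vector (Vec (Fin 2) (r n)) (suc m) ]
    S ≡ setOf g × IsMinimalFamily g s
  minimal⇒family {S = S} ((S-gen , S-min) , ∣S∣≡k) 0<r with toFamily S ∣S∣≡k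
  ... | g , g-inj , refl =
    g , s , refl , g∈ , generates⇒gcds-d≡1 0<r g s g∈ S-gen ,
    λ j eq → S-min _ (setOf-removeAt-⊂ g g-inj j)
      -- `removeAt` is precomposition with `punchIn`, so it commutes with `d n ∘_` definitionally
      -- and `eq` fits as it is.
      (gcds-d≡1⇒generates (removeAt g j) (removeAt s j) (g∈ ∘ punchIn j) eq)
    where
    s  = λ i → proj₁ (gcd-n₀-bits n (toℕ (g i)))
    g∈ = λ i → proj₂ (gcd-n₀-bits n (toℕ (g i)))

  -- No deletion of one index leaves a generating family. A proper subset misses some `g j` and so
  -- lies in such a reduced set, which gives minimality; a repeated value could be deleted without
  -- changing the set, which gives injectivity and hence the size.
  family⇒minimal : ∀ {m} → 0 < r n →
    (g : Vector (Fin n) (suc m)) (s : Vector (Vec (Fin 2) (r n)) (suc m)) →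
    IsMinimalFamily g s → setOf g ∈ G n (suc m)
  family⇒minimal {m} 0<r g s (g∈ , gcds≡1 , gcds≢1) =
    (gen , T-minimal) , ∣setOf∣ g g-inj
    where
    gen : IsGeneratingSet n (setOf g)
    gen = gcds-d≡1⇒generates g s g∈ gcds≡1

    removeAt-¬gen : ∀ j → ¬ IsGeneratingSet n (setOf (removeAt g j))
    removeAt-¬gen j = gcds≢1 j ∘
      generates⇒gcds-d≡1 0<r (removeAt g j) (removeAt s j) (g∈ ∘ punchIn j)

    T-minimal : ∀ T → T ⊂ setOf g → ¬ IsGeneratingSet n T
    T-minimal T (T⊆S , x , x∈S , x∉T) T-gen with ∈-setOf⁻ g x∈S
    ... | j , refl = removeAt-¬gen j (generates-mono T⊆ T-gen)
      where
      T⊆ : T ⊆ setOf (removeAt g j)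
      T⊆ y∈T with ∈-setOf⁻ g (T⊆S y∈T)
      -- The element is not `g j`, because it lies in `T` and `g j` does not.
      ... | i , refl = ∈-setOf-removeAt g λ { refl → x∉T y∈T }

    g-inj : Injective _≡_ _≡_ g
    g-inj {i} {j} eq with i ≟ᶠ j
    ... | yes i≡j = i≡j
    ... | no  i≢j = contradiction (generates-mono S⊆ gen) (removeAt-¬gen i)
      where
      S⊆ : setOf g ⊆ setOf (removeAt g i)
      S⊆ y∈S with ∈-setOf⁻ g y∈S
      ... | l , refl with i ≟ᶠ l
      ...   | no  i≢l  = ∈-setOf-removeAt g i≢l
      -- The deleted value `g i` is still present as `g j`.
      ...   | yes refl = subst (Subset._∈ setOf (removeAt g i)) (sym eq) (∈-setOf-removeAt g i≢j)

theorem2p0p6 : (n : ℕ) .{{_ : NonZero n}} →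
    ((k : ℕ) → Satisfiable (G n k) → k ≤ r n) ×
    (2 < r n → (m : ℕ) → let k = suc m in
    G n k ≐ λ S →
    Σ[ g ∈ Vector (Fin n) k ] Σ[ s ∈ Vector (Vec (Fin 2) (r n)) k ]
    S ≡ setOf g ×
    ((i : Fin k) → g i ∈ [ d n (s i) ]) ×
    gcds (d n ∘ s) ≡ 1 ×
    ((j : Fin k) → gcds (removeAt (d n ∘ s) j) ≢ 1))
theorem2p0p6 n =
  (λ { k (S , S∈) → minimal⇒≤r n k S S∈ }) ,
  λ 2<r m → let 0<r = ≤-trans (s≤s z≤n) 2<r in
    (λ S∈ → minimal⇒family n S∈ 0<r) ,
    (λ { (g , s , refl , fam) → family⇒minimal n 0<r g s fam })
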